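{- Let $\Delta\ge3$ be an integer. If $G$ is a finite loopless multigraph with maximum degree $\Delta(G)\le\Delta$ and no connected component of $G$ is isomorphic to the simple graph $K_{\Delta,\Delta}$, then $$q_B(G)\le\Delta(\Delta-1).$$
   Context: Multigraphs are loopless and may have parallel edges; degrees are counted with multiplicity, and $\Delta(G)$ is the maximum degree. A $4$-cycle has four distinct vertices (and four edges); in a multigraph, different choices of parallel edges may determine distinct $4$-cycles. A $B$-coloring of $G$ is a proper edge-coloring (any two distinct edges sharing an endpoint, in particular any two parallel edges, receive distinct colors) in which the edges of every $4$-cycle receive four distinct colors; $q_B(G)$ is the minimum number of colors in a $B$-coloring of $G$. -}

module Defs where

open import Data.Nat using (ℕ; zero; suc; _≤_; z≤n; s≤s)
open import Data.Fin using (Fin)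
import Data.Fin.Properties as Fin
open import Data.List using (length; filter; map; allFin)
open import Data.List.Extrema.Nat using (max)
open import Data.Vec as Vec using (Vec; []; _∷_; lookup; tabulate)
open import Data.Vec.Properties using (lookup∘tabulate; map-cong; map-id)
open import Data.Vec.Relation.Unary.AllPairs using ([]; _∷_; allPairs?)
open import Data.Vec.Relation.Unary.All using ([]; _∷_)
open import Data.Vec.Relation.Unary.Unique.Propositional using (Unique)
open import Data.Product using (∃; _×_; _,_; proj₁; proj₂)
open import Data.Sum using (_⊎_; inj₁; inj₂)
open import Data.Empty using (⊥-elim)
import Data.Irrelevant as Irrelevant
open import Data.Refinement using (Refinement-syntax; value; _,_)
open import Function using (id; _∘_)
open import Function.Bundles using (_↔_; Inverse)
open import Relation.Binary.Construct.Closure.ReflexiveTransitive using (Star)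
open import Relation.Binary.PropositionalEquality
  using (_≡_; _≢_; _≗_; refl; sym; trans; cong; subst)
open import Relation.Nullary using (Dec; yes; no)
open import Relation.Nullary.Decidable
  using (_×-dec_; _⊎-dec_; _→-dec_; ¬?; map′)
open import Relation.Unary using (Pred; Decidable)
open import Level using (0ℓ)

-- The order of the two ends of an edge carries no meaning: everything below
-- refers to it only through `Joins` and `Incident`, or symmetrically.
record Multigraph (V E : Set) : Set where
  field
    ends     : E → V × V
    loopless : ∀ e → proj₁ (ends e) ≢ proj₂ (ends e)

  src tgt : E → V
  src = proj₁ ∘ ends
  tgt = proj₂ ∘ ends

  Joins : E → V → V → Set
  Joins e u v = (src e ≡ u × tgt e ≡ v) ⊎ (src e ≡ v × tgt e ≡ u)

  Incident : E → V → Set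
  Incident e v = src e ≡ v ⊎ tgt e ≡ v

  Adjacent : V → V → Set
  Adjacent u v = ∃ λ e → Joins e u v

  Connected : V → V → Set
  Connected = Star Adjacent

  IsFourCycle : Vec V 4 → Vec E 4 → Set
  IsFourCycle vs@(v₀ ∷ v₁ ∷ v₂ ∷ v₃ ∷ []) (e₀ ∷ e₁ ∷ e₂ ∷ e₃ ∷ []) =
    Unique vs × Joins e₀ v₀ v₁ × Joins e₁ v₁ v₂ × Joins e₂ v₂ v₃ × Joins e₃ v₃ v₀

  IsProper : {C : Set} → (E → C) → Set
  IsProper c = ∀ e f v → e ≢ f → Incident e v → Incident f v → c e ≢ c f

  IsBColoring : {C : Set} → (E → C) → Set
  IsBColoring c =
    IsProper c × (∀ vs es → IsFourCycle vs es → Unique (Vec.map c es))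

  BColorable : ℕ → Set
  BColorable k = ∃ λ (c : E → Fin k) → IsBColoring c

open Multigraph

record _≅_ {V E V′ E′ : Set} (G : Multigraph V E) (H : Multigraph V′ E′) : Set where
  field
    vertices : V ↔ V′
    edges    : E ↔ E′
    ends-≅   : ∀ e → Joins H (Inverse.to edges e)
                       (Inverse.to vertices (src G e))
                       (Inverse.to vertices (tgt G e))

K : (a b : ℕ) → Multigraph (Fin a ⊎ Fin b) (Fin a × Fin b)
K a b = record
  { ends     = λ (i , j) → inj₁ i , inj₂ j
  ; loopless = λ _ ()
  }

-- Membership proofs are irrelevant in a refinement type, so the vertices and
-- edges below are genuine subsets of V and E: two of them are equal as soon as
-- their values are.
induced : {V E : Set} (G : Multigraph V E) (P : Pred V 0ℓ) →
          Multigraph [ v ∈ V ∣ P v ] [ e ∈ E ∣ P (src G e) × P (tgt G e) ]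
induced G P = record
  { ends     = λ (e , p) → (src G e , Irrelevant.map proj₁ p)
                         , (tgt G e , Irrelevant.map proj₂ p)
  ; loopless = λ (e , _) eq → loopless G e (cong value eq)
  }

-- Every connected component is the component of one of its vertices.
component : {V E : Set} (G : Multigraph V E) (v : V) →
            Multigraph [ w ∈ V ∣ Connected G v w ]
                       [ e ∈ E ∣ Connected G v (src G e) × Connected G v (tgt G e) ]
component G v = induced G (Connected G v)

IsMinimum : Pred ℕ 0ℓ → ℕ → Set
IsMinimum P q = P q × (∀ k → P k → q ≤ k)

minimum : {P : Pred ℕ 0ℓ} → Decidable P → ∀ n → P n → ∃ (IsMinimum P)
minimum P? n pn with P? 0
... | yes p₀ = 0 , p₀ , λ _ _ → z≤n
minimum P? zero    p₀ | no ¬p₀ = 0 , p₀ , λ _ _ → z≤n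
minimum P? (suc n) pn | no ¬p₀ with minimum (P? ∘ suc) n pn
... | q , pq , least = suc q , pq , λ where
  zero    p₀ → ⊥-elim (¬p₀ p₀)
  (suc k) pk → s≤s (least k pk)

allVec? : ∀ {n} k {P : Pred (Vec (Fin n) k) 0ℓ} → Decidable P → Dec (∀ xs → P xs)
allVec? zero    P? = map′ (λ { p [] → p }) (λ f → f []) (P? [])
allVec? (suc k) P? =
  map′ (λ { f (x ∷ xs) → f x xs }) (λ f x xs → f (x ∷ xs))
       (Fin.all? λ x → allVec? k (P? ∘ (x ∷_)))

anyVec? : ∀ {n} k {P : Pred (Vec (Fin n) k) 0ℓ} → Decidable P → Dec (∃ P)
anyVec? zero    P? = map′ ([] ,_) (λ { ([] , p) → p }) (P? [])
anyVec? (suc k) P? =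
  map′ (λ (x , xs , p) → x ∷ xs , p) (λ { (x ∷ xs , p) → x , xs , p })
       (Fin.any? λ x → anyVec? k (P? ∘ (x ∷_)))

IsBColoring-resp-≗ : {V E C : Set} (G : Multigraph V E) {c d : E → C} →
                     c ≗ d → IsBColoring G c → IsBColoring G d
IsBColoring-resp-≗ G c≗d (proper , four) =
  (λ e f v e≢f i j eq → proper e f v e≢f i j (trans (c≗d e) (trans eq (sym (c≗d f))))) ,
  (λ vs es cyc → subst Unique (map-cong c≗d es) (four vs es cyc))

joins-sym : {V E : Set} (G : Multigraph V E) {e : E} {u v : V} → Joins G e u v → Joins G e v u
joins-sym G (inj₁ p) = inj₂ p
joins-sym G (inj₂ p) = inj₁ p

joins-≢ : {V E : Set} (G : Multigraph V E) {e f : E} {u v x y : V} →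
          Joins G e u v → Joins G f x y → u ≢ x → u ≢ y → e ≢ f
joins-≢ G (inj₁ (p , _)) (inj₁ (q , _)) u≢x _ refl = u≢x (trans (sym p) q)
joins-≢ G (inj₁ (p , _)) (inj₂ (q , _)) _ u≢y refl = u≢y (trans (sym p) q)
joins-≢ G (inj₂ (_ , p)) (inj₁ (_ , q)) _ u≢y refl = u≢y (trans (sym p) q)
joins-≢ G (inj₂ (_ , p)) (inj₂ (_ , q)) u≢x _ refl = u≢x (trans (sym p) q)

fourCycle-edges-unique : {V E : Set} (G : Multigraph V E) →
                         ∀ vs es → IsFourCycle G vs es → Unique es
fourCycle-edges-unique G (v₀ ∷ v₁ ∷ v₂ ∷ v₃ ∷ []) (e₀ ∷ e₁ ∷ e₂ ∷ e₃ ∷ [])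
  ( (v₀≢v₁ ∷ v₀≢v₂ ∷ v₀≢v₃ ∷ []) ∷ (v₁≢v₂ ∷ v₁≢v₃ ∷ []) ∷ (v₂≢v₃ ∷ []) ∷ [] ∷ []
  , j₀ , j₁ , j₂ , j₃ ) =
  ( joins-≢ G j₀ j₁ v₀≢v₁ v₀≢v₂
  ∷ joins-≢ G j₀ j₂ v₀≢v₂ v₀≢v₃
  ∷ joins-≢ G (joins-sym G j₀) j₃ v₁≢v₃ (v₀≢v₁ ∘ sym)
  ∷ []) ∷
  ( joins-≢ G j₁ j₂ v₁≢v₂ v₁≢v₃
  ∷ joins-≢ G j₁ j₃ v₁≢v₃ (v₀≢v₁ ∘ sym)
  ∷ []) ∷
  ( joins-≢ G j₂ j₃ v₂≢v₃ (v₀≢v₂ ∘ sym)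
  ∷ []) ∷ [] ∷ []

module _ {n m : ℕ} (G : Multigraph (Fin n) (Fin m)) where

  incident? : ∀ v → Decidable (λ e → Incident G e v)
  incident? v e = (src G e Fin.≟ v) ⊎-dec (tgt G e Fin.≟ v)

  degree : Fin n → ℕ
  degree v = length (filter (incident? v) (allFin m))

  maxDegree : ℕ
  maxDegree = max 0 (map degree (allFin n))

  joins? : ∀ e u v → Dec (Joins G e u v)
  joins? e u v = ((src G e Fin.≟ u) ×-dec (tgt G e Fin.≟ v))
           ⊎-dec ((src G e Fin.≟ v) ×-dec (tgt G e Fin.≟ u))

  unique? : ∀ {k l} → Decidable (Unique {A = Fin k} {n = l})
  unique? = allPairs? (λ x y → ¬? (x Fin.≟ y))

  isFourCycle? : ∀ vs es → Dec (IsFourCycle G vs es)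
  isFourCycle? vs@(v₀ ∷ v₁ ∷ v₂ ∷ v₃ ∷ []) (e₀ ∷ e₁ ∷ e₂ ∷ e₃ ∷ []) =
    unique? vs ×-dec joins? e₀ v₀ v₁ ×-dec joins? e₁ v₁ v₂
               ×-dec joins? e₂ v₂ v₃ ×-dec joins? e₃ v₃ v₀

  isBColoring? : ∀ {k} (c : Fin m → Fin k) → Dec (IsBColoring G c)
  isBColoring? c =
    (Fin.all? λ e → Fin.all? λ f → Fin.all? λ v →
       ¬? (e Fin.≟ f) →-dec incident? v e →-dec incident? v f →-dec ¬? (c e Fin.≟ c f))
    ×-dec
    (allVec? 4 λ vs → allVec? 4 λ es → isFourCycle? vs es →-dec unique? (Vec.map c es))

  bColorable? : Decidable (BColorable G)
  bColorable? k =
    map′ (λ (xs , p) → lookup xs , p)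
         (λ (c , p) → tabulate c , IsBColoring-resp-≗ G (sym ∘ lookup∘tabulate c) p)
         (anyVec? m (isBColoring? ∘ lookup))

  -- Giving all edges different colors is a B-coloring, so a minimum exists.
  bColorable-m : BColorable G m
  bColorable-m = id , (λ e f v e≢f _ _ → e≢f) ,
    λ vs es cyc → subst Unique (sym (map-id es)) (fourCycle-edges-unique G vs es cyc)

  q-B-minimum : ∃ (IsMinimum (BColorable G))
  q-B-minimum = minimum bColorable? m bColorable-m

  q-B : ℕ
  q-B = proj₁ q-B-minimum

{-# OPTIONS --safe #-}

-- Call two edges in conflict when they are opposite in a closed walk of length
-- four; the colourings sought are the proper colourings of this conflict relation.
-- Write Δ = d + 1. By induction on a set U of vertices, the edges inside U are
-- coloured with Δ d colours.
--
-- If some u in U has at most d neighbours in U, colour the edges inside U \ {u}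
-- first. Every edge in conflict with an edge of U at u meets a neighbour of u in
-- U, so together with the edges at u itself only d Δ edges are involved.
--
-- Otherwise U is a union of components on which the graph is simple and
-- Δ-regular. Choose r in U and colour everything but the edges at r first. For v in
-- N(r), the edges in conflict with r v correspond to pairs of adjacent w in N(r)
-- and y in N(v) \ {r}; their number is Δ d minus the sum over w in N(r) of
-- |N(v) \ N(w)|. Let x have a largest class of twins (vertices with the same
-- neighbourhood) in U, of size t, and let r be a non-twin of x adjacent to some
-- τ in N(x); if there is no such r, the component of x is K_{Δ,Δ}. If exactly one
-- of v and w is in N(x), then |N(v) \ N(w)| ≥ t, and this makes the sum at least
-- d: every edge at r has at least d admissible colours. As there are only d + 1
-- of these edges, the colouring fails only if all of them have the same d
-- admissible colours. Then t = 1 and |N(v) \ N(w)| ≤ 1 on N(r), which is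
-- incompatible with every edge r v seeing each forbidden colour exactly once.
module Submission where

open import Data.Nat using (ℕ; zero; suc; _+_; _*_; _∸_; _≤_; _<_; z≤n; s≤s; _≤?_; _<?_)
open import Data.Nat.Properties
  using ( +-assoc; +-comm; +-suc; *-comm; *-identityʳ; *-zeroʳ; *-distribˡ-+
        ; +-mono-≤; +-mono-≤-<; +-monoˡ-≤; +-monoʳ-≤; *-monoˡ-≤; *-monoʳ-≤
        ; +-cancelˡ-≤; +-cancelʳ-≤; m≤m+n; m≤n+m; n≤1+n; m+[n∸m]≡n
        ; ≤-trans; ≤-reflexive; ≤-antisym; ≤-pred; <⇒≤; <⇒≱; ≰⇒>
        ; <-irrefl; ≤-<-trans; <-≤-trans; module ≤-Reasoning)
open import Data.Nat.ListAction using (sum)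
open import Data.Nat.Solver using (module +-*-Solver)
open import Data.Fin using (Fin)
import Data.Fin.Properties as Fin
open import Data.List
  using (List; []; _∷_; _++_; length; filter; map; allFin; concatMap; lookup)
open import Data.List.Extrema.Nat using (argmax; argmax-all; f[xs]≤f[argmax]; xs≤max)
open import Data.List.Membership.DecPropositional using () renaming (_∈?_ to mem?)
open import Data.List.Membership.Propositional using (_∈_; _∉_; lose; find)
open import Data.List.Membership.Propositional.Properties
  using ( ∈-map⁺; ∈-map⁻; ∈-filter⁺; ∈-filter⁻; ∈-++⁺ˡ; ∈-++⁺ʳ; ∈-concatMap⁺; ∈-concatMap⁻
        ; ∈-allFin; ∈-length; ∈-lookup)
open import Data.List.Properties
  using (length-map; length-++; length-tabulate; filter-notAll; filter-≐; ≡-dec)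
open import Data.List.Relation.Binary.Subset.Propositional using (_⊆_)
open import Data.List.Relation.Unary.All as All using ([]; _∷_)
open import Data.List.Relation.Unary.AllPairs using ([]; _∷_)
open import Data.List.Relation.Unary.Any using (here; there; index)
open import Data.List.Relation.Unary.Any.Properties using (lookup-index)
open import Data.List.Relation.Unary.Unique.Propositional using (Unique)
open import Data.List.Relation.Unary.Unique.Propositional.Properties using (allFin⁺; filter⁺)
open import Data.Vec as Vec using ([]; _∷_)
open import Data.Vec.Relation.Unary.All using ([]; _∷_)
open import Data.Vec.Relation.Unary.AllPairs using ([]; _∷_)
import Data.Vec.Relation.Unary.Unique.Propositional as Vec
open import Data.Vec.Functional using (updateAt)
open import Data.Vec.Functional.Properties using (updateAt-updates; updateAt-minimal)
open import Data.Product using (∃; ∃₂; _×_; _,_; proj₁; proj₂; uncurry)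
open import Data.Sum using (_⊎_; inj₁; inj₂) renaming ([_,_] to either)
open import Data.Empty using (⊥; ⊥-elim)
import Data.Empty.Irrelevant as Irr
open import Data.Irrelevant as Irrelevant using (Irrelevant; [_])
open import Data.Refinement using (Refinement; _,_; value-injective)
open import Data.Unit using (⊤; tt)
open import Function using (_∘_; const; _↔_; mk↔ₛ′)
open import Function.Bundles using (Inverse)
open import Relation.Binary.Construct.Closure.ReflexiveTransitive using (ε; _◅_)
open import Relation.Binary.PropositionalEquality
  using (_≡_; _≢_; refl; sym; trans; cong; cong₂; subst; subst₂)
open import Relation.Nullary using (¬_; Dec; yes; no)
open import Relation.Nullary.Decidable using (¬?; decidable-stable; _×-dec_)
open import Relation.Unary using (Pred; Decidable)
open import Level using (0ℓ)
open import Defs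
open Multigraph
open +-*-Solver using (solve; _:=_; _:+_; _:*_; con)

private variable
  A B : Set
  n k : ℕ

-- Lists over finite sets: deletion, counting and pigeonhole.

_∈?_ : (x : Fin n) (xs : List (Fin n)) → Dec (x ∈ xs)
_∈?_ = mem? Fin._≟_

InjectiveOn : List A → (A → B) → Set
InjectiveOn xs f = ∀ {x y} → x ∈ xs → y ∈ xs → f x ≡ f y → x ≡ y

without : Fin n → List (Fin n) → List (Fin n)
without v = filter (λ w → ¬? (w Fin.≟ v))

module _ {v : Fin n} {xs : List (Fin n)} where

  without⇒ : ∀ {w} → w ∈ without v xs → w ∈ xs × w ≢ v
  without⇒ = ∈-filter⁻ (λ w → ¬? (w Fin.≟ v))

  ∈-without : ∀ {w} → w ∈ xs → w ≢ v → w ∈ without v xs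
  ∈-without = ∈-filter⁺ (λ w → ¬? (w Fin.≟ v))

  ∈-∷-without : ∀ {w} → w ∈ xs → w ∈ v ∷ without v xs
  ∈-∷-without {w} w∈ with w Fin.≟ v
  ... | yes w≡v = here w≡v
  ... | no w≢v = there (∈-without w∈ w≢v)

  without-< : v ∈ xs → length (without v xs) < length xs
  without-< v∈ = filter-notAll (λ w → ¬? (w Fin.≟ v)) xs (lose v∈ λ v≢v → v≢v refl)

  without-unique : Unique xs → Unique (without v xs)
  without-unique = filter⁺ (λ w → ¬? (w Fin.≟ v))

  ∷-without-unique : Unique xs → Unique (v ∷ without v xs)
  ∷-without-unique u = All.tabulate (λ w∈ → proj₂ (without⇒ w∈) ∘ sym) ∷ without-unique u

unique-⊆⇒length≤ : {xs ys : List (Fin n)} → Unique xs → xs ⊆ ys → length xs ≤ length ys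
unique-⊆⇒length≤ [] _ = z≤n
unique-⊆⇒length≤ (x∉ ∷ u) ⊆ys =
  ≤-<-trans (unique-⊆⇒length≤ u (λ y∈ → ∈-without (⊆ys (there y∈)) (All.lookup x∉ y∈ ∘ sym)))
            (without-< (⊆ys (here refl)))

filter-length-+ : {P : Pred A 0ℓ} (P? : Decidable P) (xs : List A) →
                  length (filter P? xs) + length (filter (¬? ∘ P?) xs) ≡ length xs
filter-length-+ P? [] = refl
filter-length-+ P? (x ∷ xs) with P? x
... | yes _ = cong suc (filter-length-+ P? xs)
... | no  _ = trans (+-suc _ _) (cong suc (filter-length-+ P? xs))

nonempty⇒∃ : (xs : List A) → 1 ≤ length xs → ∃ (_∈ xs)
nonempty⇒∃ (x ∷ _) _ = x , here refl

length≤1⇒≡ : {xs : List A} → length xs ≤ 1 → ∀ {x y} → x ∈ xs → y ∈ xs → x ≡ y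
length≤1⇒≡ {xs = _ ∷ []} _ (here p) (here q) = trans p (sym q)
length≤1⇒≡ {xs = _ ∷ _ ∷ _} (s≤s ()) _ _

fresh : (xs : List (Fin k)) → length xs < k → ∃ (_∉ xs)
fresh {k} xs len< with Fin.any? (λ a → ¬? (a ∈? xs))
... | yes p = p
... | no ¬p = ⊥-elim (<⇒≱ len< (≤-trans
    (≤-reflexive (sym (length-tabulate {n = k} (λ a → a))))
    (unique-⊆⇒length≤ (allFin⁺ k)
      (λ {a} _ → decidable-stable (a ∈? xs) (λ a∉ → ¬p (a , a∉))))))

-- A repeated value need be listed only once. In the colouring this turns two constraints of the
-- same colour into an additional free colour.
injectiveOn-⊎-shorter : (f : A → Fin k) (xs : List A) →
  InjectiveOn xs f ⊎ ∃ λ ys → map f xs ⊆ ys × length ys < length xs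
injectiveOn-⊎-shorter f [] = inj₁ λ ()
injectiveOn-⊎-shorter f (x ∷ xs) with f x ∈? map f xs
... | yes fx∈ = inj₂ (map f xs
                     , (λ { (here refl) → fx∈ ; (there p) → p })
                     , s≤s (≤-reflexive (length-map f xs)))
... | no fx∉ with injectiveOn-⊎-shorter f xs
... | inj₂ (ys , sub , len<) =
        inj₂ (f x ∷ ys , (λ { (here p) → here p ; (there p) → there (sub p) }) , s≤s len<)
... | inj₁ inj = inj₁ λ where
        (here refl) (here refl) _ → refl
        (here refl) (there q) eq → ⊥-elim (fx∉ (subst (_∈ map f xs) (sym eq) (∈-map⁺ f q)))
        (there p) (here refl) eq → ⊥-elim (fx∉ (subst (_∈ map f xs) eq (∈-map⁺ f p)))
        (there p) (there q) eq → inj p q eq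

-- Sums over lists.

∑ : List A → (A → ℕ) → ℕ
∑ xs f = sum (map f xs)

∑-mono-≤ : (xs : List A) {f g : A → ℕ} → (∀ {x} → x ∈ xs → f x ≤ g x) → ∑ xs f ≤ ∑ xs g
∑-mono-≤ [] _ = z≤n
∑-mono-≤ (x ∷ xs) le = +-mono-≤ (le (here refl)) (∑-mono-≤ xs (le ∘ there))

∑-+ : (xs : List A) (f g : A → ℕ) → ∑ xs (λ x → f x + g x) ≡ ∑ xs f + ∑ xs g
∑-+ [] f g = refl
∑-+ (x ∷ xs) f g rewrite ∑-+ xs f g =
  solve 4 (λ a b s t → a :+ b :+ (s :+ t) := a :+ s :+ (b :+ t)) refl (f x) (g x) (∑ xs f) (∑ xs g)

∑-const : (xs : List A) (c : ℕ) → ∑ xs (const c) ≡ length xs * c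
∑-const [] c = refl
∑-const (x ∷ xs) c = cong (c +_) (∑-const xs c)

∑-*ˡ : (xs : List A) (c : ℕ) (f : A → ℕ) → ∑ xs (λ x → c * f x) ≡ c * ∑ xs f
∑-*ˡ [] c f = sym (*-zeroʳ c)
∑-*ˡ (x ∷ xs) c f = trans (cong (c * f x +_) (∑-*ˡ xs c f)) (sym (*-distribˡ-+ c _ _))

length-concatMap : (f : A → List B) (xs : List A) → length (concatMap f xs) ≡ ∑ xs (length ∘ f)
length-concatMap f [] = refl
length-concatMap f (x ∷ xs) = trans (length-++ (f x)) (cong (length (f x) +_) (length-concatMap f xs))

⟦_⟧ : {P : Set} → Dec P → ℕ
⟦ yes _ ⟧ = 1
⟦ no  _ ⟧ = 0

∑-⟦⟧ : {P : Pred A 0ℓ} (P? : Decidable P) (xs : List A) → ∑ xs (⟦_⟧ ∘ P?) ≡ length (filter P? xs)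
∑-⟦⟧ P? [] = refl
∑-⟦⟧ P? (x ∷ xs) with P? x
... | yes _ = cong suc (∑-⟦⟧ P? xs)
... | no  _ = ∑-⟦⟧ P? xs

∈-length-filter : {P : Pred A 0ℓ} (P? : Decidable P) {xs : List A} {x : A} →
                  x ∈ xs → P x → 1 ≤ length (filter P? xs)
∈-length-filter P? x∈ px = ∈-length (∈-filter⁺ P? x∈ px)

-- Greedy list colouring with distinct colours.

-- The head is coloured last, so an element has to avoid its own list and the
-- colours of the elements after it.
Room : (A → List (Fin k)) → List A → Set
Room L [] = ⊤
Room {k = k} L (x ∷ xs) = length (L x) + length xs < k × Room L xs

uniform-room : (L : A → List (Fin k)) (xs : List A) →
               (∀ {x} → x ∈ xs → length (L x) + length xs ≤ k) → Room L xs
uniform-room L [] _ = tt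
uniform-room L (x ∷ xs) le =
  ≤-trans (≤-reflexive (sym (+-suc _ _))) (le (here refl)) ,
  uniform-room L xs (λ x∈ → ≤-trans (+-monoʳ-≤ (length (L _)) (n≤1+n _)) (le (there x∈)))

-- Once the tail is coloured, its colours and the list of the head together exclude fewer than `k`
-- colours. `g₀` supplies the values outside `xs`.
list-colouring : (L : Fin n → List (Fin k)) (xs : List (Fin n)) → Unique xs → Room L xs →
  (Fin n → Fin k) → ∃ λ (g : Fin n → Fin k) → (∀ {x} → x ∈ xs → g x ∉ L x) × InjectiveOn xs g
list-colouring L [] _ _ g = g , (λ ()) , λ ()
list-colouring L (x ∷ xs) (x∉ ∷ u) (len< , room) g₀
  with list-colouring L xs u room g₀
... | g , avoids , inj
  with fresh (L x ++ map g xs)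
         (subst (_< _) (sym (trans (length-++ (L x)) (cong (length (L x) +_) (length-map g xs)))) len<)
... | a , a∉ = g′ , avoids′ , inj′
  where
  g′ = updateAt g x (const a)
  g′x : g′ x ≡ a
  g′x = updateAt-updates x g
  g′y : ∀ {y} → y ∈ xs → g′ y ≡ g y
  g′y y∈ = updateAt-minimal _ x g (All.lookup x∉ y∈ ∘ sym)
  a≢ : ∀ {y} → y ∈ xs → g′ x ≢ g′ y
  a≢ y∈ eq = a∉ (∈-++⁺ʳ (L x) (subst (_∈ _) (trans (sym (g′y y∈)) (trans (sym eq) g′x)) (∈-map⁺ g y∈)))
  avoids′ : ∀ {y} → y ∈ x ∷ xs → g′ y ∉ L y
  avoids′ (here refl) p = a∉ (∈-++⁺ˡ (subst (_∈ L x) g′x p))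
  avoids′ (there y∈) p = avoids y∈ (subst (_∈ L _) (g′y y∈) p)
  inj′ : InjectiveOn (x ∷ xs) g′
  inj′ (here refl) (here refl) _ = refl
  inj′ (here refl) (there q) eq = ⊥-elim (a≢ q eq)
  inj′ (there p) (here refl) eq = ⊥-elim (a≢ p (sym eq))
  inj′ (there p) (there q) eq = inj p q (trans (sym (g′y p)) (trans eq (g′y q)))

-- Neighbourhoods in a finite graph.

module Neighbourhoods {n : ℕ} (_~_ : Fin n → Fin n → Set) (_~?_ : ∀ u v → Dec (u ~ v))
  (~-sym : ∀ {u v} → u ~ v → v ~ u) where

  N : Fin n → List (Fin n)
  N v = filter (v ~?_) (allFin n)

  ∈N : ∀ {v w} → v ~ w → w ∈ N v
  ∈N {v} {w} = ∈-filter⁺ (v ~?_) (∈-allFin w)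

  N⇒~ : ∀ {v w} → w ∈ N v → v ~ w
  N⇒~ {v} w∈ = proj₂ (∈-filter⁻ (v ~?_) {xs = allFin n} w∈)

  N-sym : ∀ {v w} → w ∈ N v → v ∈ N w
  N-sym = ∈N ∘ ~-sym ∘ N⇒~

  N-unique : ∀ v → Unique (N v)
  N-unique v = filter⁺ (v ~?_) (allFin⁺ n)

-- Twins in a regular graph.

module Regular {n d : ℕ} (_~_ : Fin n → Fin n → Set) (_~?_ : ∀ u v → Dec (u ~ v))
  (~-sym : ∀ {u v} → u ~ v → v ~ u)
  (U : List (Fin n)) (closed : ∀ {u v} → u ∈ U → u ~ v → v ∈ U)
  (regular : ∀ {v} → v ∈ U → length (filter (v ~?_) (allFin n)) ≡ suc d) where

  open Neighbourhoods _~_ _~?_ ~-sym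

  N-closed : ∀ {v w} → v ∈ U → w ∈ N v → w ∈ U
  N-closed v∈ = closed v∈ ∘ N⇒~

  -- Both sets have `suc d` elements, so inclusion forces the same members. As both are filtered
  -- from `allFin n`, even the lists coincide, which is why twins can be defined by equality of
  -- lists.
  N-⊆⇒≡ : ∀ {v w} → v ∈ U → w ∈ U → N v ⊆ N w → N v ≡ N w
  N-⊆⇒≡ {v} {w} v∈ w∈ sub =
    filter-≐ (v ~?_) (w ~?_) (N⇒~ ∘ sub ∘ ∈N , N⇒~ ∘ sup ∘ ∈N) (allFin n)
    where
    sup : N w ⊆ N v
    sup {x} x∈ with x ∈? N v
    ... | yes p = p
    ... | no x∉ = ⊥-elim (<-irrefl (trans (regular v∈) (sym (regular w∈)))
      (unique-⊆⇒length≤ {xs = x ∷ N v} {N w}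
        (All.tabulate (λ y∈ x≡y → x∉ (subst (_∈ N v) (sym x≡y) y∈)) ∷ N-unique v)
        λ { (here refl) → x∈ ; (there p) → sub p }))

  N-≢⇒∃ : ∀ {v w} → v ∈ U → w ∈ U → N v ≢ N w → ∃ λ z → z ∈ N v × z ∉ N w
  N-≢⇒∃ {v} {w} v∈ w∈ neq with Fin.any? (λ z → (z ∈? N v) ×-dec ¬? (z ∈? N w))
  ... | yes p = p
  ... | no ¬p = ⊥-elim (neq (N-⊆⇒≡ v∈ w∈
                  λ {z} z∈ → decidable-stable (z ∈? N w) λ z∉ → ¬p (z , z∈ , z∉)))

  twin? : ∀ v w → Dec (N v ≡ N w)
  twin? v w = ≡-dec Fin._≟_ (N v) (N w)

  twins : Fin n → List (Fin n)
  twins v = filter (twin? v) (allFin n)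

  ∈-twins : ∀ {v w} → N v ≡ N w → w ∈ twins v
  ∈-twins {v} {w} = ∈-filter⁺ (twin? v) (∈-allFin w)

  twins⇒≡ : ∀ {v w} → w ∈ twins v → N v ≡ N w
  twins⇒≡ {v} w∈ = proj₂ (∈-filter⁻ (twin? v) {xs = allFin n} w∈)

  twins-unique : ∀ v → Unique (twins v)
  twins-unique v = filter⁺ (twin? v) (allFin⁺ n)

  -- Counting the constraints on the edges at the root.

  module Root (d≥2 : 2 ≤ d) {x τ r : Fin n} (x∈U : x ∈ U)
    (x-max : ∀ {v} → v ∈ U → length (twins v) ≤ length (twins x))
    (τ∈Nx : τ ∈ N x) (r∈Nτ : r ∈ N τ) (r-not-twin : N r ≢ N x) where

    τ∈U : τ ∈ U
    τ∈U = N-closed x∈U τ∈Nx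

    r∈U : r ∈ U
    r∈U = N-closed τ∈U r∈Nτ

    Nr⊆U : N r ⊆ U
    Nr⊆U = N-closed r∈U

    M : Fin n → List (Fin n)
    M v = without r (N v)

    ∈M : ∀ {v w} → w ∈ N v → w ≢ r → w ∈ M v
    ∈M = ∈-without

    M⇒ : ∀ {v w} → w ∈ M v → w ∈ N v × w ≢ r
    M⇒ {v} = without⇒ {xs = N v}

    M-unique : ∀ v → Unique (M v)
    M-unique v = without-unique (N-unique v)

    length-M : ∀ {v} → v ∈ N r → length (M v) ≡ d
    length-M {v} v∈ = ≤-antisym
      (≤-pred (≤-trans (without-< (N-sym v∈)) (≤-reflexive (regular (Nr⊆U v∈)))))
      (≤-pred (≤-trans (≤-reflexive (sym (regular (Nr⊆U v∈))))
                       (unique-⊆⇒length≤ {ys = r ∷ M v} (N-unique v) ∈-∷-without)))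

    -- For `w` in `N r`, the vertex `r` is itself in `N w`, so `miss v w` is all of N(v) minus N(w),
    -- although `M v` leaves out `r`.
    common miss : Fin n → Fin n → List (Fin n)
    common v w = filter (w ~?_) (M v)
    miss v w = filter (¬? ∘ (w ~?_)) (M v)

    common+miss : ∀ {v} w → v ∈ N r → length (common v w) + length (miss v w) ≡ d
    common+miss {v} w v∈ = trans (filter-length-+ (w ~?_) (M v)) (length-M v∈)

    ∈miss : ∀ {v w y} → y ∈ N v → y ∉ N w → r ∈ N w → y ∈ miss v w
    ∈miss {v} {w} {y} y∈ y∉ r∈ =
      ∈-filter⁺ (¬? ∘ (w ~?_)) (∈M y∈ λ { refl → y∉ r∈ }) (y∉ ∘ ∈N)

    common-≤ : ∀ v w → length (common v w) ≤ length (common w v)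
    common-≤ v w = unique-⊆⇒length≤ (filter⁺ (w ~?_) (M-unique v)) λ y∈ →
      let y∈M , w~y = ∈-filter⁻ (w ~?_) {xs = M v} y∈
      in ∈-filter⁺ (v ~?_) (∈M (∈N w~y) (proj₂ (M⇒ {v} y∈M))) (N⇒~ (proj₁ (M⇒ {v} y∈M)))

    -- `M v` and `M w` both have `d` elements and share the same common part, so what remains of
    -- them can be compared.
    miss-≤ : ∀ {v w} → v ∈ N r → w ∈ N r → length (miss w v) ≤ length (miss v w)
    miss-≤ {v} {w} v∈ w∈ = +-cancelˡ-≤ (length (common v w)) _ _ (begin
      length (common v w) + length (miss w v) ≤⟨ +-monoˡ-≤ _ (common-≤ v w) ⟩
      length (common w v) + length (miss w v) ≡⟨ common+miss v w∈ ⟩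
      d                                       ≡⟨ common+miss w v∈ ⟨
      length (common v w) + length (miss v w) ∎)
      where open ≤-Reasoning

    -- The ordered pairs whose edges may not share the colour of the edge r v.
    pairs : Fin n → List (Fin n × Fin n)
    pairs v = concatMap (λ w → map (w ,_) (common v w)) (N r)

    ∈pairs : ∀ {v w y} → w ∈ N r → y ∈ N v → y ≢ r → w ~ y → (w , y) ∈ pairs v
    ∈pairs {v} {w} w∈ y∈ y≢r w~y =
      ∈-concatMap⁺ (λ w → map (w ,_) (common v w))
        (lose w∈ (∈-map⁺ (w ,_) (∈-filter⁺ (w ~?_) (∈M y∈ y≢r) w~y)))

    pairs⇒ : ∀ {v w y} → (w , y) ∈ pairs v → w ∈ N r × y ∈ N v × y ≢ r × w ~ y
    pairs⇒ {v} p∈ with find (∈-concatMap⁻ (λ w → map (w ,_) (common v w)) {xs = N r} p∈)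
    ... | w′ , w′∈ , q with ∈-map⁻ (w′ ,_) q
    ... | y , y∈ , refl with ∈-filter⁻ (w′ ~?_) {xs = M v} y∈
    ... | y∈M , w~y with M⇒ {v} y∈M
    ... | y∈N , y≢r = w′∈ , y∈N , y≢r , w~y

    -- Sum `common+miss` over the `suc d` vertices of `N r`. Each non-twin of `v` is expected to
    -- contribute one miss; `h` records the surplus over that, and the bracket pays for the twins,
    -- which contribute none.
    pairs-bound : ∀ {v} → v ∈ N r → (h : Fin n → ℕ) →
      (∀ {w} → w ∈ N r → suc (h w) ≤ length (miss v w) + ⟦ twin? v w ⟧) →
      length (pairs v) + suc d + ∑ (N r) h ≤ suc d * d + length (twins v)
    pairs-bound {v} v∈ h le = begin
      length (pairs v) + suc d + ∑ (N r) h
        ≡⟨ +-assoc (length (pairs v)) _ _ ⟩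
      length (pairs v) + (suc d + ∑ (N r) h)
        ≡⟨ cong₂ (λ a b → a + (b + ∑ (N r) h)) length-pairs (sym length-Nr) ⟩
      ∑ (N r) c + (∑ (N r) (const 1) + ∑ (N r) h)
        ≡⟨ cong (∑ (N r) c +_) (∑-+ (N r) (const 1) h) ⟨
      ∑ (N r) c + ∑ (N r) (suc ∘ h)
        ≡⟨ ∑-+ (N r) c (suc ∘ h) ⟨
      ∑ (N r) (λ w → c w + suc (h w))
        ≤⟨ ∑-mono-≤ (N r) pointwise ⟩
      ∑ (N r) (λ w → d + ⟦ twin? v w ⟧)
        ≡⟨ ∑-+ (N r) (const d) (λ w → ⟦ twin? v w ⟧) ⟩
      ∑ (N r) (const d) + ∑ (N r) (λ w → ⟦ twin? v w ⟧)
        ≡⟨ cong₂ _+_ (trans (∑-const (N r) d) (cong (_* d) (regular r∈U))) (∑-⟦⟧ (twin? v) (N r)) ⟩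
      suc d * d + length (filter (twin? v) (N r))
        ≤⟨ +-monoʳ-≤ (suc d * d) (unique-⊆⇒length≤ (filter⁺ (twin? v) (N-unique r))
             λ w∈ → ∈-twins (proj₂ (∈-filter⁻ (twin? v) {xs = N r} w∈))) ⟩
      suc d * d + length (twins v) ∎
      where
      open ≤-Reasoning
      c : Fin n → ℕ
      c w = length (common v w)
      length-pairs : length (pairs v) ≡ ∑ (N r) c
      length-pairs = trans (length-concatMap _ (N r)) (∑-map (N r))
        where
        ∑-map : ∀ ws → ∑ ws (λ w → length (map (w ,_) (common v w))) ≡ ∑ ws c
        ∑-map [] = refl
        ∑-map (w ∷ ws) = cong₂ _+_ (length-map (w ,_) (common v w)) (∑-map ws)
      length-Nr : ∑ (N r) (const 1) ≡ suc d
      length-Nr = trans (∑-const (N r) 1) (trans (*-identityʳ _) (regular r∈U))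
      pointwise : ∀ {w} → w ∈ N r → c w + suc (h w) ≤ d + ⟦ twin? v w ⟧
      pointwise {w} w∈ = begin
        c w + suc (h w) ≤⟨ +-monoʳ-≤ (c w) (le w∈) ⟩
        c w + (length (miss v w) + ⟦ twin? v w ⟧) ≡⟨ +-assoc (c w) _ _ ⟨
        c w + length (miss v w) + ⟦ twin? v w ⟧ ≡⟨ cong (_+ ⟦ twin? v w ⟧) (common+miss w v∈) ⟩
        d + ⟦ twin? v w ⟧ ∎

    1≤miss+twin : ∀ {v w} → v ∈ N r → w ∈ N r → 1 ≤ length (miss v w) + ⟦ twin? v w ⟧
    1≤miss+twin {v} {w} v∈ w∈ with twin? v w
    ... | yes _ = m≤n+m 1 _
    ... | no neq = let z , z∈ , z∉ = N-≢⇒∃ (Nr⊆U v∈) (Nr⊆U w∈) neq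
                   in ≤-trans (∈-length (∈miss z∈ z∉ (N-sym w∈))) (m≤m+n _ 0)

    -- Every twin of `x` is adjacent to `v` and not to `w`, so the whole twin class of `x` is
    -- missed.
    far : ∀ {v w} → w ∈ N r → v ∈ N x → w ∉ N x →
          length (twins x) ≤ length (miss v w)
    far {v} {w} w∈ v∈x w∉x = unique-⊆⇒length≤ (twins-unique x) λ x′∈ →
      let eq = twins⇒≡ x′∈ in
      ∈miss (N-sym (subst (v ∈_) eq v∈x)) (λ x′∈w → w∉x (subst (w ∈_) (sym eq) (N-sym x′∈w))) (N-sym w∈)

    far′ : ∀ {v w} → v ∈ N r → w ∈ N r → v ∉ N x → w ∈ N x →
           length (twins x) ≤ length (miss v w)
    far′ v∈ w∈ v∉x w∈x = ≤-trans (far v∈ w∈x v∉x) (miss-≤ v∈ w∈)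

    -- The surplus of a far vertex over the one miss that every non-twin contributes.
    t′ : ℕ
    t′ = length (twins x) ∸ 1

    suc-t′ : suc t′ ≡ length (twins x)
    suc-t′ = m+[n∸m]≡n (∈-length (∈-twins {x} refl))

    -- `pairs-bound` with surplus `t′` on the vertices satisfying `P`; by the choice of `x`, the
    -- twins of `v` number at most `suc t′`.
    far-bound : ∀ {v} → v ∈ N r → {P : Pred (Fin n) 0ℓ} (P? : Decidable P) →
      (∀ {w} → w ∈ N r → P w → length (twins x) ≤ length (miss v w)) →
      length (pairs v) + d + t′ * length (filter P? (N r)) ≤ suc d * d + t′
    far-bound {v} v∈ P? P⇒far = ≤-pred (begin
      suc (length (pairs v) + d + t′ * length (filter P? (N r)))
        ≡⟨ cong (_+ t′ * length (filter P? (N r))) (+-suc (length (pairs v)) d) ⟨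
      length (pairs v) + suc d + t′ * length (filter P? (N r))
        ≡⟨ cong (length (pairs v) + suc d +_)
             (trans (∑-*ˡ (N r) t′ (⟦_⟧ ∘ P?)) (cong (t′ *_) (∑-⟦⟧ P? (N r)))) ⟨
      length (pairs v) + suc d + ∑ (N r) (λ w → t′ * ⟦ P? w ⟧)
        ≤⟨ pairs-bound v∈ (λ w → t′ * ⟦ P? w ⟧) pointwise ⟩
      suc d * d + length (twins v)
        ≤⟨ +-monoʳ-≤ (suc d * d) (≤-trans (x-max (Nr⊆U v∈)) (≤-reflexive (sym suc-t′))) ⟩
      suc d * d + suc t′
        ≡⟨ +-suc (suc d * d) t′ ⟩
      suc (suc d * d + t′) ∎)
      where
      open ≤-Reasoning
      pointwise : ∀ {w} → w ∈ N r → suc (t′ * ⟦ P? w ⟧) ≤ length (miss v w) + ⟦ twin? v w ⟧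
      pointwise {w} w∈ with P? w
      ... | yes p = ≤-trans (≤-reflexive (trans (cong suc (*-identityʳ t′)) suc-t′))
                            (≤-trans (P⇒far w∈ p) (m≤m+n _ _))
      ... | no _ = ≤-trans (≤-reflexive (cong suc (*-zeroʳ t′))) (1≤miss+twin v∈ w∈)

    τ∈Nr : τ ∈ N r
    τ∈Nr = N-sym r∈Nτ

    outside : ∃ λ z → z ∈ N r × z ∉ N x
    outside = N-≢⇒∃ r∈U x∈U r-not-twin

    z : Fin n
    z = proj₁ outside

    z∈Nr : z ∈ N r
    z∈Nr = proj₁ (proj₂ outside)

    z∉Nx : z ∉ N x
    z∉Nx = proj₂ (proj₂ outside)

    Nx? : Decidable (_∈ N x)
    Nx? w = w ∈? N x

    -- `N r` meets both sides of `N x`, in `τ` and in `z`, so every `v` has a far vertex opposite to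
    -- it. Having `1 ≤ c` is what lets `t′` cancel in `pairs-≤`.
    side-bound : ∀ {v} → v ∈ N r → ∃ λ c → 1 ≤ c ×
      length (pairs v) + d + t′ * c ≤ suc d * d + t′
    side-bound {v} v∈ with v ∈? N x
    ... | yes p = _ , ∈-length-filter (¬? ∘ Nx?) z∈Nr z∉Nx
                , far-bound v∈ (¬? ∘ Nx?) (λ w∈ w∉ → far w∈ p w∉)
    ... | no ¬p = _ , ∈-length-filter Nx? τ∈Nr τ∈Nx
                , far-bound v∈ Nx? (λ w∈ w∈x → far′ v∈ w∈ ¬p w∈x)

    pairs-≤ : ∀ {v} → v ∈ N r → length (pairs v) ≤ d * d
    pairs-≤ {v} v∈ with side-bound v∈
    ... | suc c , _ , le = +-cancelˡ-≤ d _ _ (≤-trans (≤-reflexive (+-comm d _))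
            (+-cancelʳ-≤ t′ _ _ (≤-trans (+-monoʳ-≤ (length (pairs v) + d)
              (≤-trans (≤-reflexive (sym (*-identityʳ t′))) (*-monoʳ-≤ t′ (s≤s z≤n)))) le)))

    Short : Fin n → Set
    Short v = length (pairs v) < d * d

    -- Two far vertices give a surplus of at least `t′ + t′`, which exceeds the allowance `t′` for
    -- twins as soon as `t′` is positive.
    short-of : ∀ {v c} → length (pairs v) + d + t′ * c ≤ suc d * d + t′ → 2 ≤ c → 1 ≤ t′ → Short v
    short-of {v} {c} le c≥2 t≥1 = +-cancelʳ-≤ (d + t′) _ _ (begin
      suc (length (pairs v)) + (d + t′)
        ≡⟨ solve 3 (λ a b c → con 1 :+ a :+ (b :+ c) := a :+ b :+ (con 1 :+ c)) refl (length (pairs v)) d t′ ⟩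
      length (pairs v) + d + (1 + t′)
        ≤⟨ +-monoʳ-≤ (length (pairs v) + d) (≤-trans (+-monoˡ-≤ t′ t≥1)
             (≤-trans (≤-reflexive (solve 1 (λ t → t :+ t := t :* con 2) refl t′)) (*-monoʳ-≤ t′ c≥2))) ⟩
      length (pairs v) + d + t′ * c
        ≤⟨ le ⟩
      suc d * d + t′
        ≡⟨ solve 2 (λ d t → (con 1 :+ d) :* d :+ t := d :* d :+ (d :+ t)) refl d t′ ⟩
      d * d + (d + t′) ∎)
      where
      open ≤-Reasoning

    -- N r has at least three vertices, so two of them lie on the same side of N x;
    -- a vertex of N r on the other side is far from both.
    short-or-no-twins : (∃ λ v → v ∈ N r × Short v) ⊎ length (twins x) ≤ 1
    short-or-no-twins with 1 ≤? t′
    ... | no ¬p = inj₂ (≤-trans (≤-reflexive (sym suc-t′)) (≰⇒> ¬p))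
    ... | yes t≥1 with 2 ≤? length (filter Nx? (N r))
    ... | yes c≥2 = inj₁ (z , z∈Nr ,
            short-of (far-bound z∈Nr Nx? (λ w∈ → far′ z∈Nr w∈ z∉Nx)) c≥2 t≥1)
    ... | no c≱2 = inj₁ (τ , τ∈Nr ,
            short-of (far-bound τ∈Nr (¬? ∘ Nx?) (λ w∈ → far w∈ τ∈Nx)) c′≥2 t≥1)
      where
      c′≥2 : 2 ≤ length (filter (¬? ∘ Nx?) (N r))
      c′≥2 = +-cancelˡ-≤ 1 _ _ (≤-trans (s≤s d≥2) (≤-trans
        (≤-reflexive (trans (sym (regular r∈U)) (sym (filter-length-+ Nx? (N r)))))
        (+-monoˡ-≤ _ (≤-pred (≰⇒> c≱2)))))

    -- The case of trivial twin classes.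

    module NoTwins (t≤1 : length (twins x) ≤ 1)
      (not-short : ∀ {v} → v ∈ N r → ¬ Short v) where

      twin⇒≡ : ∀ {v w} → v ∈ U → N v ≡ N w → v ≡ w
      twin⇒≡ v∈ eq = length≤1⇒≡ (≤-trans (x-max v∈) t≤1) (∈-twins refl) (∈-twins eq)

      -- Two misses at a single `w₀` would be a surplus of one there, and `pairs-bound` with the
      -- indicator of `w₀` as `h` would make `v` short.
      miss≤1 : ∀ {v w} → v ∈ N r → w ∈ N r → length (miss v w) ≤ 1
      miss≤1 {v} {w₀} v∈ w₀∈ with length (miss v w₀) ≤? 1
      ... | yes p = p
      ... | no ¬p = ⊥-elim (not-short v∈ (+-cancelʳ-≤ (suc d) _ _ (begin
        suc (length (pairs v)) + suc d
          ≡⟨ +-comm 1 (length (pairs v) + suc d) ⟩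
        length (pairs v) + suc d + 1
          ≤⟨ +-monoʳ-≤ (length (pairs v) + suc d)
               (≤-trans (∈-length-filter (Fin._≟ w₀) w₀∈ refl) (≤-reflexive (sym (∑-⟦⟧ (Fin._≟ w₀) (N r))))) ⟩
        length (pairs v) + suc d + ∑ (N r) (λ w → ⟦ w Fin.≟ w₀ ⟧)
          ≤⟨ pairs-bound v∈ (λ w → ⟦ w Fin.≟ w₀ ⟧) pointwise ⟩
        suc d * d + length (twins v)
          ≤⟨ +-monoʳ-≤ (suc d * d) (≤-trans (x-max (Nr⊆U v∈)) t≤1) ⟩
        suc d * d + 1
          ≡⟨ solve 1 (λ d → (con 1 :+ d) :* d :+ con 1 := d :* d :+ (con 1 :+ d)) refl d ⟩
        d * d + suc d ∎)))
        where
        open ≤-Reasoning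
        pointwise : ∀ {w} → w ∈ N r → suc ⟦ w Fin.≟ w₀ ⟧ ≤ length (miss v w) + ⟦ twin? v w ⟧
        pointwise {w} w∈ with w Fin.≟ w₀
        ... | yes refl = ≤-trans (≰⇒> ¬p) (m≤m+n _ _)
        ... | no _ = 1≤miss+twin v∈ w∈

      miss-≡ : ∀ {v w y y′} → v ∈ N r → w ∈ N r → y ∈ N v → y ∉ N w → y′ ∈ N v → y′ ∉ N w → y ≡ y′
      miss-≡ v∈ w∈ y∈ y∉ y′∈ y′∉ =
        length≤1⇒≡ (miss≤1 v∈ w∈) (∈miss y∈ y∉ (N-sym w∈)) (∈miss y′∈ y′∉ (N-sym w∈))

      -- A colour at y common to τ and z reappears at some y′ seen from a w not
      -- adjacent to y; then y′ is invisible from τ and z, which forces them to be twins.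
      lists-differ : ∀ {k} (χ : Fin n → Fin n → Fin k) →
        (∀ {v} → v ∈ N r → InjectiveOn (pairs v) (uncurry χ)) →
        (∀ {v w a} → v ∈ N r → w ∈ N r →
           a ∈ map (uncurry χ) (pairs v) → a ∈ map (uncurry χ) (pairs w)) → ⊥
      lists-differ χ inj same
        -- `M τ` has `d ≥ 2` elements and at most one of them is outside `N z`.
        with nonempty⇒∃ (common τ z) (+-cancelʳ-≤ 1 _ _ (≤-trans d≥2
               (≤-trans (≤-reflexive (sym (common+miss z τ∈Nr))) (+-monoʳ-≤ (length (common τ z)) (miss≤1 τ∈Nr z∈Nr)))))
      ... | y , y∈c with ∈-filter⁻ (z ~?_) {xs = M τ} y∈c
      ... | y∈M , z~y with M⇒ {τ} y∈M
      ... | y∈Nτ , y≢r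
        -- `r` and `y` are distinct, hence not twins, so some neighbour `w` of `r` is not adjacent
        -- to `y`.
        with N-≢⇒∃ r∈U (N-closed τ∈U y∈Nτ) (λ eq → y≢r (sym (twin⇒≡ r∈U eq)))
      ... | w , w∈Nr , w∉Ny
        -- The pair `(τ , y)` is itself among the pairs of `τ`, so its colour is also seen from `w`,
        -- at some pair `(x′ , y′)`.
        with ∈-map⁻ (uncurry χ) (same τ∈Nr w∈Nr
               (∈-map⁺ (uncurry χ) (∈pairs τ∈Nr y∈Nτ y≢r (N⇒~ y∈Nτ))))
      ... | (x′ , y′) , p∈ , eq with pairs⇒ {w} p∈
      ... | x′∈Nr , y′∈Nw , y′≢r , x′~y′
        -- Only `τ` lies in `N x`, so `τ` and `z` differ and are not twins.
        with N-≢⇒∃ τ∈U (Nr⊆U z∈Nr) (λ eq → z∉Nx (subst (_∈ N x) (twin⇒≡ τ∈U eq) τ∈Nx))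
      ... | s , s∈Nτ , s∉Nz = invisible τ∈Nr y∈Nτ (subst (_∈ N τ) s≡y′ s∈Nτ)
        where
        y∉Nw : y ∉ N w
        y∉Nw = w∉Ny ∘ N-sym
        -- If `v` were adjacent to both `y` and `y′`, it would see the colour at two pairs;
        -- injectivity would give `y = y′`, but only `y′` is adjacent to `w`.
        invisible : ∀ {v} → v ∈ N r → y ∈ N v → y′ ∉ N v
        invisible v∈ y∈ y′∈ with inj v∈ (∈pairs τ∈Nr y∈ y≢r (N⇒~ y∈Nτ)) (∈pairs x′∈Nr y′∈ y′≢r x′~y′) eq
        ... | refl = y∉Nw y′∈Nw
        -- The only neighbour of `τ` outside `N w` is `y`, and `s` is not `y` because `z` is
        -- adjacent to `y`.
        s∈Nw : s ∈ N w
        s∈Nw = decidable-stable (s ∈? N w) λ s∉ →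
          s∉Nz (subst (_∈ N z) (miss-≡ τ∈Nr w∈Nr y∈Nτ y∉Nw s∈Nτ s∉) (∈N z~y))
        s≡y′ : s ≡ y′
        s≡y′ = miss-≡ w∈Nr z∈Nr s∈Nw s∉Nz y′∈Nw (invisible z∈Nr (∈N z~y))

    -- Choosing the colours at the root.

    module Colours (χ : Fin n → Fin n → Fin (suc d * d)) (g₀ : Fin n → Fin (suc d * d)) where

      seen : Fin n → List (Fin (suc d * d))
      seen v = map (uncurry χ) (pairs v)

      seen-≤ : ∀ {v} → v ∈ N r → length (seen v) ≤ d * d
      seen-≤ {v} v∈ = ≤-trans (≤-reflexive (length-map (uncurry χ) (pairs v))) (pairs-≤ v∈)

      Solution : Set
      Solution = ∃ λ (g : Fin n → Fin (suc d * d)) →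
        InjectiveOn (N r) g × (∀ {v} → v ∈ N r → g v ∉ seen v)

      d*d+d≡k : d * d + d ≡ suc d * d
      d*d+d≡k = +-comm (d * d) d

      without-Nr : ∀ {v} → v ∈ N r → length (without v (N r)) ≤ d
      without-Nr v∈ = ≤-pred (≤-trans (without-< v∈) (≤-reflexive (regular r∈U)))

      -- The other vertices, at most `d` of them, have at least `d` free colours each. `v` is
      -- coloured last and has at least `d + 1`, so one survives.
      colour-short : ∀ {v ys} → v ∈ N r → seen v ⊆ ys → length ys < d * d → Solution
      colour-short {v} {ys} v∈ sub len< =
        let g , avoids , inj = list-colouring L (v ∷ rest) (∷-without-unique (N-unique r))
                                 (first , uniform-room L rest others) g₀
        in g , (λ p q → inj (∈-∷-without p) (∈-∷-without q))
             , (λ p q → avoids (∈-∷-without p) (seen⊆L q))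
        where
        rest = without v (N r)
        L : Fin n → List (Fin (suc d * d))
        L w with w Fin.≟ v
        ... | yes _ = ys
        ... | no _ = seen w
        seen⊆L : ∀ {w} → seen w ⊆ L w
        seen⊆L {w} q with w Fin.≟ v
        ... | yes refl = sub q
        ... | no _ = q
        first : length (L v) + length rest < suc d * d
        first with v Fin.≟ v
        ... | yes _ = ≤-trans (+-mono-≤ len< (without-Nr v∈)) (≤-reflexive d*d+d≡k)
        ... | no v≢v = ⊥-elim (v≢v refl)
        others : ∀ {w} → w ∈ rest → length (L w) + length rest ≤ suc d * d
        others {w} w∈ with w Fin.≟ v
        ... | yes _ = ≤-trans (+-mono-≤ (<⇒≤ len<) (without-Nr v∈)) (≤-reflexive d*d+d≡k)
        ... | no _ = ≤-trans (+-mono-≤ (seen-≤ (proj₁ (without⇒ {xs = N r} w∈))) (without-Nr v∈)) (≤-reflexive d*d+d≡k)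

      -- Give v the colour a and let w, which is not allowed a anyway, come last.
      colour-differ : ∀ {v w a} → v ∈ N r → w ∈ N r → a ∈ seen w → a ∉ seen v → Solution
      colour-differ {v} {w} {a} v∈ w∈ a∈ a∉ =
        g′ , g′-inj , g′-avoids
        where
        rest₀ = without v (N r)
        rest = without w rest₀
        w≢v : w ≢ v
        w≢v refl = a∉ a∈
        rest-< : length rest < d
        rest-< = ≤-trans (without-< (∈-without w∈ w≢v)) (without-Nr v∈)
        in-order : ∀ {u} → u ∈ N r → u ≢ v → u ∈ w ∷ rest
        in-order u∈ u≢v = ∈-∷-without (∈-without u∈ u≢v)
        -- Reserving `a` for `v` adds it to every list except that of `w`, which contains it
        -- already. As `rest` has fewer than `d` vertices, there is room for this extra entry.
        L : Fin n → List (Fin (suc d * d))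
        L u with u Fin.≟ w
        ... | yes _ = seen w
        ... | no _ = a ∷ seen u
        a∈L : ∀ u → a ∈ L u
        a∈L u with u Fin.≟ w
        ... | yes _ = a∈
        ... | no _ = here refl
        seen⊆L : ∀ {u} → seen u ⊆ L u
        seen⊆L {u} q with u Fin.≟ w
        ... | yes refl = q
        ... | no _ = there q
        first : length (L w) + length rest < suc d * d
        first with w Fin.≟ w
        ... | yes _ = ≤-trans (+-mono-≤-< (seen-≤ w∈) rest-<) (≤-reflexive d*d+d≡k)
        ... | no w≢w = ⊥-elim (w≢w refl)
        others : ∀ {u} → u ∈ rest → length (L u) + length rest ≤ suc d * d
        others {u} u∈ with u Fin.≟ w
        ... | yes _ = <⇒≤ (≤-trans (+-mono-≤-< (seen-≤ w∈) rest-<) (≤-reflexive d*d+d≡k))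
        ... | no _ = ≤-trans (+-mono-≤-< (seen-≤ (proj₁ (without⇒ {xs = N r} (proj₁ (without⇒ {xs = rest₀} u∈))))) rest-<)
                             (≤-reflexive d*d+d≡k)
        colouring = list-colouring L (w ∷ rest) (∷-without-unique (without-unique (N-unique r)))
                                   (first , uniform-room L rest others) g₀
        g = proj₁ colouring
        avoids = proj₁ (proj₂ colouring)
        inj = proj₂ (proj₂ colouring)
        g′ = updateAt g v (const a)
        g′v : g′ v ≡ a
        g′v = updateAt-updates v g
        g′≡ : ∀ {u} → u ≢ v → g′ u ≡ g u
        g′≡ u≢v = updateAt-minimal _ v g u≢v
        ≢a : ∀ {u} → u ∈ N r → u ≢ v → g′ u ≢ a
        ≢a {u} u∈ u≢v eq = avoids (in-order u∈ u≢v) (subst (_∈ L u) (trans (sym eq) (g′≡ u≢v)) (a∈L u))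
        g′-avoids : ∀ {u} → u ∈ N r → g′ u ∉ seen u
        g′-avoids {u} u∈ q with u Fin.≟ v
        ... | yes refl = a∉ (subst (_∈ seen v) g′v q)
        ... | no u≢v = avoids (in-order u∈ u≢v) (seen⊆L (subst (_∈ seen u) (g′≡ u≢v) q))
        g′-inj : InjectiveOn (N r) g′
        g′-inj {p} {q} p∈ q∈ eq with p Fin.≟ v | q Fin.≟ v
        ... | yes refl | yes refl = refl
        ... | yes refl | no q≢v = ⊥-elim (≢a q∈ q≢v (trans (sym eq) g′v))
        ... | no p≢v | yes refl = ⊥-elim (≢a p∈ p≢v (trans eq g′v))
        ... | no p≢v | no q≢v = inj (in-order p∈ p≢v) (in-order q∈ q≢v)
                                  (trans (sym (g′≡ p≢v)) (trans eq (g′≡ q≢v)))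

      colour-pairs-short : ∀ {v} → v ∈ N r → Short v → Solution
      colour-pairs-short {v} v∈ short =
        colour-short v∈ (λ q → q) (≤-<-trans (≤-reflexive (length-map (uncurry χ) (pairs v))) short)

      -- The greedy choice succeeds if some vertex has few pairs, if two vertices see different
      -- colour sets, or if a vertex sees a colour twice. When all three fail, `lists-differ` gives
      -- a contradiction.
      solution : Solution
      solution with Fin.any? (λ v → (v ∈? N r) ×-dec (length (pairs v) <? d * d))
      ... | yes (v , v∈ , short) = colour-pairs-short v∈ short
      ... | no none-short with short-or-no-twins
      ... | inj₁ short = ⊥-elim (none-short short)
      ... | inj₂ t≤1 with Fin.any? (λ v → Fin.any? λ w → Fin.any? λ a →
              (v ∈? N r) ×-dec (w ∈? N r) ×-dec (a ∈? seen w) ×-dec ¬? (a ∈? seen v))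
      ... | yes (v , w , a , v∈ , w∈ , a∈ , a∉) = colour-differ v∈ w∈ a∈ a∉
      ... | no ¬differ with All.decide (λ v → injectiveOn-⊎-shorter (uncurry χ) (pairs v)) (N r)
      ... | inj₁ inj = ⊥-elim (NoTwins.lists-differ t≤1 (λ v∈ short → none-short (_ , v∈ , short)) χ
              (λ v∈ → All.lookup inj v∈)
              (λ {v} {w} {a} v∈ w∈ a∈ → decidable-stable (a ∈? seen w)
                 λ a∉ → ¬differ (w , v , a , w∈ , v∈ , a∈ , a∉)))
      ... | inj₂ shorter with find shorter
      ... | v , v∈ , ys , sub , len< = colour-short v∈ sub (<-≤-trans len< (pairs-≤ v∈))

  -- χ w y stands for the colour of the edge w y, and g v for that of the edge r v.
  ColourableRoot : Fin n → Set
  ColourableRoot r = (χ : Fin n → Fin n → Fin (suc d * d)) → (Fin n → Fin (suc d * d)) →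
    ∃ λ (g : Fin n → Fin (suc d * d)) → InjectiveOn (N r) g ×
      (∀ {v w y} → r ~ v → r ~ w → v ~ y → w ~ y → y ≢ r → g v ≢ χ w y)

  -- The vertex `x` maximises the twin class over `U`. The condition being negated says that every
  -- vertex two steps from a vertex is its twin, which is how a complete bipartite component shows
  -- itself.
  colourable-root : 2 ≤ d → ∃ (_∈ U) →
    (∀ {x} → x ∈ U → ¬ (∀ τ r → τ ∈ N x → r ∈ N τ → N r ≡ N x)) →
    ∃ λ r → r ∈ U × ColourableRoot r
  colourable-root d≥2 (v₀ , v₀∈) not-complete
    with Fin.any? (λ τ → Fin.any? λ r → (τ ∈? N x) ×-dec (r ∈? N τ) ×-dec ¬? (≡-dec Fin._≟_ (N r) (N x)))
    where
    x : Fin n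
    x = argmax (length ∘ twins) v₀ U
  ... | yes (τ , r , τ∈ , r∈ , neq) = r , r∈U , λ χ g₀ →
          let g , inj , avoids = Colours.solution χ g₀ in
          g , inj , λ r~v r~w v~y w~y y≢r eq → avoids (∈N r~v)
            (subst (_∈ _) (sym eq) (∈-map⁺ (uncurry χ) (∈pairs (∈N r~w) (∈N v~y) y≢r w~y)))
    where
    open Root d≥2 (argmax-all (length ∘ twins) {P = _∈ U} v₀∈ (All.tabulate (λ p → p)))
      (λ v∈ → All.lookup (f[xs]≤f[argmax] v₀ U) v∈) τ∈ r∈ neq
  ... | no none = ⊥-elim (not-complete
          (argmax-all (length ∘ twins) {P = _∈ U} v₀∈ (All.tabulate (λ p → p)))
          λ τ r τ∈ r∈ → decidable-stable (≡-dec Fin._≟_ (N r) _) λ neq → none (τ , r , τ∈ , r∈ , neq))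

-- Recognising a complete bipartite component.

lookup-injective : {A : Set} {xs : List A} → Unique xs → ∀ {i j} → lookup xs i ≡ lookup xs j → i ≡ j
lookup-injective {xs = x ∷ xs} (x∉ ∷ u) {Fin.zero} {Fin.zero} _ = refl
lookup-injective {xs = x ∷ xs} (x∉ ∷ u) {Fin.zero} {Fin.suc j} eq = ⊥-elim (All.lookup x∉ (∈-lookup j) eq)
lookup-injective {xs = x ∷ xs} (x∉ ∷ u) {Fin.suc i} {Fin.zero} eq = ⊥-elim (All.lookup x∉ (∈-lookup i) (sym eq))
lookup-injective {xs = x ∷ xs} (x∉ ∷ u) {Fin.suc i} {Fin.suc j} eq = cong Fin.suc (lookup-injective u eq)

-- Membership in the refinement is known only irrelevantly, so `find` must compute a preimage
-- without inspecting the proof.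
refinement-↔ : {A B : Set} {P : A → Set} (f : B → A) → (∀ {b c} → f b ≡ f c → b ≡ c) →
               (∀ b → P (f b)) → (∀ a → Irrelevant (P a) → ∃ λ b → f b ≡ a) → Refinement A P ↔ B
refinement-↔ f inj P-f find = mk↔ₛ′
  (λ (a , p) → proj₁ (find a p))
  (λ b → f b , [ P-f b ])
  (λ b → inj (proj₂ (find (f b) [ P-f b ])))
  (λ (a , p) → value-injective (proj₂ (find a p)))

module _ {n m : ℕ} (G : Multigraph (Fin n) (Fin m)) where

  joins-ends : ∀ {e u v x y} → Joins G e u v → Joins G e x y → (u ≡ x × v ≡ y) ⊎ (u ≡ y × v ≡ x)
  joins-ends (inj₁ (refl , refl)) (inj₁ (refl , refl)) = inj₁ (refl , refl)
  joins-ends (inj₁ (refl , refl)) (inj₂ (refl , refl)) = inj₂ (refl , refl)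
  joins-ends (inj₂ (refl , refl)) (inj₁ (refl , refl)) = inj₂ (refl , refl)
  joins-ends (inj₂ (refl , refl)) (inj₂ (refl , refl)) = inj₁ (refl , refl)

  module CompleteBipartite {x τ : Fin n} (X T : List (Fin n)) (x∈X : x ∈ X) (τ∈T : τ ∈ T)
    (X-unique : Unique X) (T-unique : Unique T) (disjoint : ∀ {v} → v ∈ X → v ∉ T)
    (X-nbrs : ∀ {u v} → u ∈ X → Adjacent G u v → v ∈ T)
    (T-nbrs : ∀ {u v} → u ∈ T → Adjacent G u v → v ∈ X)
    (complete : ∀ {u v} → u ∈ X → v ∈ T → Adjacent G u v)
    (simple : ∀ {e f u v} → u ∈ X → Joins G e u v → Joins G f u v → e ≡ f) where

    reachable : ∀ {u w} → Connected G u w → u ∈ X ⊎ u ∈ T → w ∈ X ⊎ w ∈ T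
    reachable ε p = p
    reachable (a ◅ as) (inj₁ u∈) = reachable as (inj₂ (X-nbrs u∈ a))
    reachable (a ◅ as) (inj₂ u∈) = reachable as (inj₁ (T-nbrs u∈ a))

    vertex : Fin (length X) ⊎ Fin (length T) → Fin n
    vertex = either (lookup X) (lookup T)

    vertex-injective : ∀ {s t} → vertex s ≡ vertex t → s ≡ t
    vertex-injective {inj₁ i} {inj₁ j} eq = cong inj₁ (lookup-injective X-unique eq)
    vertex-injective {inj₁ i} {inj₂ j} eq = ⊥-elim (disjoint (∈-lookup i) (subst (_∈ T) (sym eq) (∈-lookup j)))
    vertex-injective {inj₂ i} {inj₁ j} eq = ⊥-elim (disjoint (∈-lookup j) (subst (_∈ T) eq (∈-lookup i)))
    vertex-injective {inj₂ i} {inj₂ j} eq = cong inj₂ (lookup-injective T-unique eq)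

    swap-adjacent : ∀ {u v} → Adjacent G u v → Adjacent G v u
    swap-adjacent (e , j) = e , joins-sym G j

    vertex-connected : ∀ s → Connected G x (vertex s)
    vertex-connected (inj₁ i) = complete x∈X τ∈T ◅ swap-adjacent (complete (∈-lookup i) τ∈T) ◅ ε
    vertex-connected (inj₂ j) = complete x∈X (∈-lookup j) ◅ ε

    find-vertex : ∀ w → Irrelevant (Connected G x w) → ∃ λ s → vertex s ≡ w
    -- The side of `w` is found by deciding membership; the irrelevant walk serves only to refute
    -- the case of neither side.
    find-vertex w [ c ] with w ∈? X | w ∈? T
    ... | yes p | _ = inj₁ (index p) , sym (lookup-index p)
    ... | no _ | yes q = inj₂ (index q) , sym (lookup-index q)
    ... | no ¬p | no ¬q = Irr.⊥-elim (either ¬p ¬q (reachable c (inj₁ x∈X)))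

    edge-data : (ij : Fin (length X) × Fin (length T)) → Adjacent G (lookup X (proj₁ ij)) (lookup T (proj₂ ij))
    edge-data (i , j) = complete (∈-lookup i) (∈-lookup j)

    edge : Fin (length X) × Fin (length T) → Fin m
    edge = proj₁ ∘ edge-data

    edge-joins : ∀ i j → Joins G (edge (i , j)) (lookup X i) (lookup T j)
    edge-joins i j = proj₂ (edge-data (i , j))

    edge-injective : ∀ {p q} → edge p ≡ edge q → p ≡ q
    edge-injective {i , j} {i′ , j′} eq
      with joins-ends (edge-joins i j) (subst (λ e → Joins G e _ _) (sym eq) (edge-joins i′ j′))
    ... | inj₁ (p , q) = cong₂ _,_ (lookup-injective X-unique p) (lookup-injective T-unique q)
    ... | inj₂ (p , q) = ⊥-elim (disjoint (∈-lookup i) (subst (_∈ T) (sym p) (∈-lookup j′)))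

    InComponent : Fin m → Set
    InComponent e = Connected G x (src G e) × Connected G x (tgt G e)

    edge-connected : ∀ p → InComponent (edge p)
    edge-connected (i , j) with edge-joins i j
    ... | inj₁ (p , q) = subst (Connected G x) (sym p) (vertex-connected (inj₁ i))
                       , subst (Connected G x) (sym q) (vertex-connected (inj₂ j))
    ... | inj₂ (p , q) = subst (Connected G x) (sym p) (vertex-connected (inj₂ j))
                       , subst (Connected G x) (sym q) (vertex-connected (inj₁ i))

    edge-at : ∀ {e u v} → Joins G e u v → u ∈ X → v ∈ T → ∃ λ p → edge p ≡ e
    edge-at {e} j u∈ v∈ = (index u∈ , index v∈) ,
      simple (∈-lookup (index u∈)) (edge-joins (index u∈) (index v∈))
        (subst₂ (Joins G e) (lookup-index u∈) (lookup-index v∈) j)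

    find-edge : ∀ e → Irrelevant (InComponent e) → ∃ λ p → edge p ≡ e
    find-edge e [ c ] with find-vertex (src G e) [ proj₁ c ]
    ... | inj₁ i , eq = edge-at (inj₁ (refl , refl)) src∈
                          (X-nbrs src∈ (e , inj₁ (refl , refl)))
      where src∈ = subst (_∈ X) eq (∈-lookup i)
    ... | inj₂ j , eq = edge-at (inj₂ (refl , refl)) (T-nbrs src∈ (e , inj₁ (refl , refl))) src∈
      where src∈ = subst (_∈ T) eq (∈-lookup j)

    iso : component G x ≅ K (length X) (length T)
    iso = record
      { vertices = vertices
      ; edges    = edges
      ; ends-≅   = ends-≅
      }
      where
      vertices = refinement-↔ vertex (λ {s} {t} → vertex-injective {s} {t}) vertex-connected find-vertex
      edges = refinement-↔ edge edge-injective edge-connected find-edge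
      locate : ∀ {w} c s → vertex s ≡ w → s ≡ Inverse.to vertices (w , c)
      locate {w} c s eq = vertex-injective {s} (trans eq (sym (proj₂ (find-vertex w c))))
      ends-≅ : ∀ e → Joins (K (length X) (length T)) (Inverse.to edges e)
                 (Inverse.to vertices (src (component G x) e)) (Inverse.to vertices (tgt (component G x) e))
      ends-≅ (e , c) with find-edge e c
      ... | (i , j) , refl with edge-joins i j
      ... | inj₁ (p , q) = inj₁ (locate (Irrelevant.map proj₁ c) (inj₁ i) (sym p) ,
                                 locate (Irrelevant.map proj₂ c) (inj₂ j) (sym q))
      ... | inj₂ (p , q) = inj₂ (locate (Irrelevant.map proj₂ c) (inj₁ i) (sym q) ,
                                 locate (Irrelevant.map proj₁ c) (inj₂ j) (sym p))

-- Conflicts and colourings of the edges inside a vertex set.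

module Colouring {n m : ℕ} (G : Multigraph (Fin n) (Fin m)) where

  _~_ : Fin n → Fin n → Set
  _~_ = Adjacent G

  _~?_ : ∀ u v → Dec (u ~ v)
  u ~? v = Fin.any? (λ e → joins? G e u v)

  ~-sym : ∀ {u v} → u ~ v → v ~ u
  ~-sym (e , j) = e , joins-sym G j

  ~-irrefl : ∀ {v} → ¬ v ~ v
  ~-irrefl (e , inj₁ (p , q)) = loopless G e (trans p (sym q))
  ~-irrefl (e , inj₂ (p , q)) = loopless G e (trans p (sym q))

  joins⇒incident : ∀ {e u v} → Joins G e u v → Incident G e u
  joins⇒incident (inj₁ (p , _)) = inj₁ p
  joins⇒incident (inj₂ (_ , q)) = inj₂ q

  inc : Fin n → List (Fin m)
  inc v = filter (incident? G v) (allFin m)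

  ∈inc : ∀ {e v} → Incident G e v → e ∈ inc v
  ∈inc {e} {v} = ∈-filter⁺ (incident? G v) (∈-allFin e)

  degree-≤ : ∀ {Δ} → maxDegree G ≤ Δ → ∀ v → length (inc v) ≤ Δ
  degree-≤ le v = ≤-trans
    (All.lookup (xs≤max 0 (map (degree G) (allFin n))) (∈-map⁺ (degree G) (∈-allFin v))) le

  -- The opposite end when `e` is incident with `u`; for any other edge the value defaults to the
  -- source.
  other : Fin n → Fin m → Fin n
  other u e with src G e Fin.≟ u
  ... | yes _ = tgt G e
  ... | no _ = src G e

  other-joins : ∀ {u e} → Incident G e u → Joins G e u (other u e)
  other-joins {u} {e} i with src G e Fin.≟ u
  other-joins i        | yes p = inj₁ (p , refl)
  other-joins (inj₁ p) | no ¬p = ⊥-elim (¬p p)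
  other-joins (inj₂ q) | no ¬p = inj₂ (refl , q)

  joins⇒other : ∀ {e u v} → Joins G e u v → other u e ≡ v
  joins⇒other j with joins-ends G (other-joins (joins⇒incident j)) j
  ... | inj₁ (_ , eq) = eq
  ... | inj₂ (refl , eq) = eq

  -- Two edges conflict when they are opposite in a closed walk of length four;
  -- degenerate walks account for the pairs of edges that share an end.
  Conflict : Fin m → Fin m → Set
  Conflict e f = e ≢ f × ∃₂ λ u v → ∃₂ λ x y → Joins G e u v × Joins G f x y × u ~ x × v ~ y

  conflict-sym : ∀ {e f} → Conflict e f → Conflict f e
  conflict-sym (neq , u , v , x , y , j , k , a , b) =
    neq ∘ sym , x , y , u , v , k , j , ~-sym a , ~-sym b

  -- Reversing `e` in the closed walk reverses `f` along with it, so any orientation of `e` may be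
  -- prescribed.
  conflict-at : ∀ {e f u v} → Joins G e u v → Conflict e f → ∃₂ λ x y → Joins G f x y × u ~ x × v ~ y
  conflict-at j (_ , _ , _ , x , y , j′ , k , a , b) with joins-ends G j j′
  ... | inj₁ (refl , refl) = x , y , k , a , b
  ... | inj₂ (refl , refl) = y , x , joins-sym G k , b , a

  Inside : List (Fin n) → Fin m → Set
  Inside U e = src G e ∈ U × tgt G e ∈ U

  inside? : ∀ U → Decidable (Inside U)
  inside? U e = (src G e ∈? U) ×-dec (tgt G e ∈? U)

  inside⇒∈ : ∀ {U e v} → Inside U e → Incident G e v → v ∈ U
  inside⇒∈ (p , _) (inj₁ refl) = p
  inside⇒∈ (_ , q) (inj₂ refl) = q

  joins-inside : ∀ {U e u v} → Inside U e → Joins G e u v → u ∈ U × v ∈ U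
  joins-inside i j = inside⇒∈ i (joins⇒incident j) , inside⇒∈ i (joins⇒incident (joins-sym G j))

  -- The edges connecting the ends of `e` and `f` are inside `U` too, so this concerns only the
  -- subgraph induced on `U`.
  Good : ∀ {k} → List (Fin n) → (Fin m → Fin k) → Set
  Good U c = ∀ {e f} → Inside U e → Inside U f → Conflict e f → c e ≢ c f

  good⇒BColoring : ∀ {k} {c : Fin m → Fin k} → Good (allFin n) c → IsBColoring G c
  good⇒BColoring {c = c} good = proper , four
    where
    inside : ∀ e → Inside (allFin n) e
    inside e = ∈-allFin _ , ∈-allFin _
    differ : ∀ {e f} → Conflict e f → c e ≢ c f
    differ = good (inside _) (inside _)
    proper : IsProper G c
    -- The walk runs along `e` and back, then along `f` and back; its first and third edges are `e`
    -- and `f`.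
    proper e f v e≢f i j = differ (e≢f , v , other v e , other v f , v , je , joins-sym G jf ,
                                   (f , jf) , (e , joins-sym G je))
      where
      je = other-joins i
      jf = other-joins j
    four : ∀ vs es → IsFourCycle G vs es → Vec.Unique (Vec.map c es)
    four vs@(_ ∷ _ ∷ _ ∷ _ ∷ []) es@(e₀ ∷ e₁ ∷ e₂ ∷ e₃ ∷ []) cyc@(_ , j₀ , j₁ , j₂ , j₃)
      with fourCycle-edges-unique G vs es cyc
    ... | (n₀₁ ∷ n₀₂ ∷ n₀₃ ∷ []) ∷ (n₁₂ ∷ n₁₃ ∷ []) ∷ (n₂₃ ∷ []) ∷ _ =
      (adjacent n₀₁ (joins-sym G j₀) j₁ ∷ opposite n₀₂ j₀ j₁ j₂ j₃
        ∷ adjacent n₀₃ j₀ (joins-sym G j₃) ∷ []) ∷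
      (adjacent n₁₂ (joins-sym G j₁) j₂ ∷ opposite n₁₃ j₁ j₂ j₃ j₀ ∷ []) ∷
      (adjacent n₂₃ (joins-sym G j₂) j₃ ∷ []) ∷ [] ∷ []
      where
      adjacent : ∀ {e f u v w} → e ≢ f → Joins G e u v → Joins G f u w → c e ≢ c f
      adjacent e≢f j k = proper _ _ _ e≢f (joins⇒incident j) (joins⇒incident k)
      opposite : ∀ {e f g h a b x y} → e ≢ g → Joins G e a b → Joins G f b x → Joins G g x y →
                 Joins G h y a → c e ≢ c g
      opposite {f = f} {h = h} e≢g je jf jg jh =
        differ (e≢g , _ , _ , _ , _ , je , joins-sym G jg , (h , joins-sym G jh) , (f , jf))

  inside-without : ∀ {U u e} → Inside U e → ¬ Incident G e u → Inside (without u U) e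
  inside-without {u = u} (p , q) ¬i = ∈-without p (¬i ∘ inj₁) , ∈-without q (¬i ∘ inj₂)

  without-¬incident : ∀ {U u e} → Inside (without u U) e → ¬ Incident G e u
  without-¬incident {U} i inc = proj₂ (without⇒ {xs = U} (inside⇒∈ i inc)) refl

  star : List (Fin n) → Fin n → List (Fin m)
  star U u = filter (λ e → incident? G u e ×-dec inside? U e) (allFin m)

  star⇒ : ∀ {U u e} → e ∈ star U u → Incident G e u × Inside U e
  star⇒ {U} {u} e∈ = proj₂ (∈-filter⁻ (λ e → incident? G u e ×-dec inside? U e) {xs = allFin m} e∈)

  ∈star : ∀ {U u e} → Incident G e u → Inside U e → e ∈ star U u
  ∈star {U} {u} {e} i j = ∈-filter⁺ (λ e → incident? G u e ×-dec inside? U e) (∈-allFin e) (i , j)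

  -- Edges inside `U` that avoid `u` lie inside `without u U`. Overriding `c` by `g` on the star
  -- therefore leaves two kinds of conflict to check: within the star, and between the star and the
  -- rest.
  extend : ∀ {k} (U : List (Fin n)) (u : Fin n) (c g : Fin m → Fin k) → Good (without u U) c →
    InjectiveOn (star U u) g →
    (∀ {e f} → e ∈ star U u → Inside (without u U) f → Conflict e f → g e ≢ c f) →
    ∃ λ (c′ : Fin m → Fin k) → Good U c′
  extend {k} U u c g good inj avoids = c′ , good′
    where
    c′ : Fin m → Fin k
    c′ e with e ∈? star U u
    ... | yes _ = g e
    ... | no _ = c e
    good′ : Good U c′
    good′ {e} {f} ie if conf with e ∈? star U u | f ∈? star U u
    ... | yes p | yes q = proj₁ conf ∘ inj p q
    ... | yes p | no q = avoids p (inside-without if (λ i → q (∈star i if))) conf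
    ... | no p | yes q = avoids q (inside-without ie (λ i → p (∈star i ie))) (conflict-sym conf) ∘ sym
    ... | no p | no q = good (inside-without ie (λ i → p (∈star i ie)))
                             (inside-without if (λ i → q (∈star i if))) conf

  nbrs : List (Fin n) → Fin n → List (Fin n)
  nbrs U u = filter (λ v → (u ~? v) ×-dec (v ∈? U)) (allFin n)

  ∈nbrs : ∀ {U u v} → u ~ v → v ∈ U → v ∈ nbrs U u
  ∈nbrs {U} {u} {v} a b = ∈-filter⁺ (λ v → (u ~? v) ×-dec (v ∈? U)) (∈-allFin v) (a , b)

  nbrs⇒ : ∀ {U u v} → v ∈ nbrs U u → u ~ v × v ∈ U
  nbrs⇒ {U} {u} v∈ = proj₂ (∈-filter⁻ (λ v → (u ~? v) ×-dec (v ∈? U)) {xs = allFin n} v∈)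

  nbrs-unique : ∀ U u → Unique (nbrs U u)
  nbrs-unique U u = filter⁺ _ (allFin⁺ n)

  -- The induction on the vertex set.

  module _ (d : ℕ) (degree≤ : ∀ v → length (inc v) ≤ suc d) where

    -- The list `around` has at most `d * suc d` entries and contains both the star of `u` and every
    -- edge in conflict with it. Splitting it by incidence with `u` bounds the forbidden colours and
    -- the star together.
    extend-few : ∀ U u (c : Fin m → Fin (suc d * d)) → length (nbrs U u) ≤ d → Good (without u U) c →
                 ∃ λ (c′ : Fin m → Fin (suc d * d)) → Good U c′
    extend-few U u c few good =
      let g , avoids , inj = list-colouring (const seen) (star U u) (filter⁺ _ (allFin⁺ m))
                               (uniform-room (const seen) (star U u) (λ _ → room)) c
      in extend U u c g good inj λ e∈ if conf eq →
           avoids e∈ (subst (_∈ seen) (sym eq) (∈seen e∈ if conf))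
      where
      around : List (Fin m)
      around = concatMap inc (nbrs U u)
      seen : List (Fin (suc d * d))
      seen = map c (filter (¬? ∘ incident? G u) around)
      ∈around : ∀ {f x} → u ~ x → x ∈ U → Incident G f x → f ∈ around
      ∈around u~x x∈ i = ∈-concatMap⁺ inc (lose (∈nbrs u~x x∈) (∈inc i))
      ∈seen : ∀ {e f} → e ∈ star U u → Inside (without u U) f → Conflict e f → c f ∈ seen
      ∈seen e∈ if conf with conflict-at (other-joins (proj₁ (star⇒ {U} e∈))) conf
      ... | x , y , j , u~x , _ = ∈-map⁺ c (∈-filter⁺ (¬? ∘ incident? G u)
              (∈around u~x (proj₁ (without⇒ {xs = U} (inside⇒∈ if (joins⇒incident j)))) (joins⇒incident j))
              (without-¬incident {U} if))
      star⊆ : star U u ⊆ filter (incident? G u) around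
      star⊆ {e} e∈ with star⇒ {U} e∈
      ... | i , ie = ∈-filter⁺ (incident? G u)
              (∈around (e , j) (proj₂ (joins-inside ie j)) (joins⇒incident (joins-sym G j))) i
        where j = other-joins i
      room : length seen + length (star U u) ≤ suc d * d
      room = begin
        length seen + length (star U u)
          ≤⟨ +-mono-≤ (≤-reflexive (length-map c (filter (¬? ∘ incident? G u) around)))
                      (unique-⊆⇒length≤ (filter⁺ _ (allFin⁺ m)) star⊆) ⟩
        length (filter (¬? ∘ incident? G u) around) + length (filter (incident? G u) around)
          ≡⟨ trans (+-comm _ (length (filter (incident? G u) around)))
                   (filter-length-+ (incident? G u) around) ⟩
        length around
          ≡⟨ length-concatMap inc (nbrs U u) ⟩
        ∑ (nbrs U u) (length ∘ inc)
          ≤⟨ ∑-mono-≤ (nbrs U u) (λ _ → degree≤ _) ⟩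
        ∑ (nbrs U u) (const (suc d))
          ≡⟨ ∑-const (nbrs U u) (suc d) ⟩
        length (nbrs U u) * suc d
          ≤⟨ *-monoˡ-≤ (suc d) few ⟩
        d * suc d
          ≡⟨ *-comm d (suc d) ⟩
        suc d * d ∎
        where open ≤-Reasoning

    -- Vertex sets in which every vertex has more than `d` neighbours.

    module Full (d≥2 : 2 ≤ d) (U : List (Fin n)) (nonempty : ∃ (_∈ U))
      (full : ∀ {u} → u ∈ U → d < length (nbrs U u))
      (no-K : ∀ v → ¬ (component G v ≅ K (suc d) (suc d))) where

      -- Without `e`, at most `d` edges remain at `u`, too few to reach its more than `d` neighbours
      -- in `U`. This excludes edges leaving `U` and parallel edges, both of which could be spared.
      essential : ∀ {u e} → u ∈ U → Incident G e u →
        ¬ (∀ {x} → x ∈ nbrs U u → ∃ λ f → f ≢ e × Joins G f u x)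
      essential {u} {e} u∈ i reach = <-irrefl refl (begin-strict
        d <⟨ full u∈ ⟩
        length (nbrs U u)
          ≤⟨ unique-⊆⇒length≤ (nbrs-unique U u) sub ⟩
        length (map (other u) (without e (inc u)))
          ≡⟨ length-map (other u) (without e (inc u)) ⟩
        length (without e (inc u))
          ≤⟨ ≤-pred (≤-trans (without-< (∈inc i)) (degree≤ u)) ⟩
        d ∎)
        where
        open ≤-Reasoning
        sub : nbrs U u ⊆ map (other u) (without e (inc u))
        sub x∈ with reach x∈
        ... | f , f≢e , j = subst (_∈ _) (joins⇒other j)
                              (∈-map⁺ (other u) (∈-without (∈inc (joins⇒incident j)) f≢e))

      closed : ∀ {u v} → u ∈ U → u ~ v → v ∈ U
      closed {u} {v} u∈ (e , j) = decidable-stable (v ∈? U) λ v∉ →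
        essential u∈ (joins⇒incident j) λ x∈ → let (f , jf) , x∈U = nbrs⇒ {U} x∈ in
          f , (λ { refl → v∉ (subst (_∈ U) (trans (sym (joins⇒other jf)) (joins⇒other j)) x∈U) }) , jf

      simple : ∀ {e f u v} → u ∈ U → Joins G e u v → Joins G f u v → e ≡ f
      simple {e} {f} {u} {v} u∈ je jf = decidable-stable (e Fin.≟ f) λ e≢f →
        essential u∈ (joins⇒incident je) λ x∈ → avoiding e≢f (nbrs⇒ {U} x∈)
        where
        avoiding : e ≢ f → ∀ {x} → u ~ x × x ∈ U → ∃ λ f′ → f′ ≢ e × Joins G f′ u x
        avoiding e≢f ((f′ , j) , _) with f′ Fin.≟ e
        ... | no f′≢e = f′ , f′≢e , j
        ... | yes refl = f , e≢f ∘ sym , subst (Joins G f u) (trans (sym (joins⇒other je)) (joins⇒other j)) jf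

      regular : ∀ {v} → v ∈ U → length (filter (v ~?_) (allFin n)) ≡ suc d
      regular {v} v∈ = ≤-antisym
        (≤-trans (unique-⊆⇒length≤ {ys = map (other v) (inc v)} (filter⁺ _ (allFin⁺ n)) sub)
          (≤-trans (≤-reflexive (length-map (other v) (inc v))) (degree≤ v)))
        (≤-trans (full v∈) (unique-⊆⇒length≤ (nbrs-unique U v)
          λ w∈ → ∈-filter⁺ (v ~?_) (∈-allFin _) (proj₁ (nbrs⇒ {U} w∈))))
        where
        sub : filter (v ~?_) (allFin n) ⊆ map (other v) (inc v)
        sub w∈ with proj₂ (∈-filter⁻ (v ~?_) {xs = allFin n} w∈)
        ... | e , j = subst (_∈ _) (joins⇒other j) (∈-map⁺ (other v) (∈inc (joins⇒incident j)))

      open Neighbourhoods _~_ _~?_ ~-sym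

      N-closed : ∀ {v w} → v ∈ U → w ∈ N v → w ∈ U
      N-closed v∈ = closed v∈ ∘ N⇒~

      -- The sides are `N τ` and `N x`. Every vertex of `N τ` has neighbourhood `N x`; a common
      -- vertex of the two sides would thus be adjacent to itself.
      not-complete : ∀ {x} → x ∈ U → ¬ (∀ τ r → τ ∈ N x → r ∈ N τ → N r ≡ N x)
      not-complete {x} x∈ twins
        with nonempty⇒∃ (N x) (≤-trans (s≤s z≤n) (≤-reflexive (sym (regular x∈))))
      ... | τ , τ∈ = no-K x (subst₂ (λ a b → component G x ≅ K a b) (regular (N-closed x∈ τ∈)) (regular x∈)
          (CompleteBipartite.iso G (N τ) (N x) (N-sym τ∈) τ∈ (N-unique τ) (N-unique x)
            (λ v∈ v∈x → ~-irrefl (N⇒~ (subst (_ ∈_) (sym (twins τ _ τ∈ v∈)) v∈x)))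
            (λ u∈ u~v → subst (_ ∈_) (twins τ _ τ∈ u∈) (∈N u~v))
            (λ u∈ u~v → N-sym (subst (τ ∈_) (sym (twins _ _ u∈ (∈N u~v))) τ∈))
            (λ u∈ v∈ → N⇒~ (subst (_ ∈_) (sym (twins τ _ τ∈ u∈)) v∈))
            (λ u∈ → simple (N-closed (N-closed x∈ τ∈) u∈))))

      ColourableRoot : Fin n → Set
      ColourableRoot = Regular.ColourableRoot _~_ _~?_ ~-sym U closed regular

      extend-root : ∀ {r} → r ∈ U → Fin (suc d * d) → ColourableRoot r → (c : Fin m → Fin (suc d * d)) →
                    Good (without r U) c → ∃ λ (c′ : Fin m → Fin (suc d * d)) → Good U c′
      extend-root {r} r∈ a₀ solve c good = extend U r c (g ∘ other r) good
            (λ p q → injective (proj₁ (star⇒ {U} p)) (proj₁ (star⇒ {U} q)))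
            (λ e∈ → avoid (proj₁ (star⇒ {U} e∈)))
          where
          χ : Fin n → Fin n → Fin (suc d * d)
          -- For `x` in `U` the edge found is the only one, by simplicity; `a₀` fills the entries of
          -- non-adjacent pairs.
          χ x y with x ~? y
          ... | yes (e , _) = c e
          ... | no _ = a₀
          χ-joins : ∀ {f x y} → x ∈ U → Joins G f x y → χ x y ≡ c f
          χ-joins {f} {x} {y} x∈ j with x ~? y
          ... | yes (e , j′) = cong c (simple x∈ j′ j)
          ... | no ¬x~y = ⊥-elim (¬x~y (f , j))
          solution = solve χ (const a₀)
          g = proj₁ solution
          injective : ∀ {e f} → Incident G e r → Incident G f r → g (other r e) ≡ g (other r f) → e ≡ f
          injective {e} {f} i j eq = simple r∈ (other-joins i)
            (subst (Joins G f r)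
              (sym (proj₁ (proj₂ solution) (∈N (e , other-joins i)) (∈N (f , other-joins j)) eq))
              (other-joins j))
          avoid : ∀ {e f} → Incident G e r → Inside (without r U) f → Conflict e f → g (other r e) ≢ c f
          avoid {e} {f} i if conf eq with conflict-at (other-joins i) conf
          ... | x , y , jf , r~x , v~y =
            proj₂ (proj₂ solution) (e , other-joins i) r~x v~y (f , jf)
              (proj₂ (without⇒ {xs = U} (proj₂ (joins-inside if jf))))
              (trans eq (sym (χ-joins (closed r∈ r~x) jf)))

      root : ∃ λ r → r ∈ U × ColourableRoot r
      root = Regular.colourable-root _~_ _~?_ ~-sym U closed regular d≥2 nonempty not-complete

    -- The bound `s` on the length of `U` makes the recursion structural.
    colouring : 2 ≤ d → (∀ v → ¬ (component G v ≅ K (suc d) (suc d))) → Fin (suc d * d) →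
      ∀ s (U : List (Fin n)) → length U ≤ s → ∃ λ (c : Fin m → Fin (suc d * d)) → Good U c
    colouring d≥2 no-K a₀ s [] _ = const a₀ , λ { (() , _) }
    colouring d≥2 no-K a₀ (suc s) U@(u₀ ∷ _) len≤ = by-size
      where
      recurse : ∀ {u} → u ∈ U → ∃ λ (c : Fin m → Fin (suc d * d)) → Good (without u U) c
      recurse {u} u∈ = colouring d≥2 no-K a₀ s (without u U)
        (≤-pred (≤-trans (without-< u∈) len≤))
      by-size : ∃ λ (c : Fin m → Fin (suc d * d)) → Good U c
      by-size with Fin.any? (λ u → (u ∈? U) ×-dec (length (nbrs U u) ≤? d))
      ... | yes (u , u∈ , few) = let c , good = recurse u∈ in extend-few U u c few good
      ... | no none =
        let open Full d≥2 U (u₀ , here refl) (λ u∈ → ≰⇒> λ few → none (_ , u∈ , few)) no-K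
            r , r∈ , solve = root
            c , good = recurse r∈
        in extend-root r∈ a₀ solve c good

theorem1p3 : (Δ : ℕ) → 3 ≤ Δ →
    (n m : ℕ) (G : Multigraph (Fin n) (Fin m)) →
    maxDegree G ≤ Δ →
    ((v : Fin n) → ¬ (component G v ≅ K Δ Δ)) →
    q-B G ≤ Δ * (Δ ∸ 1)
theorem1p3 (suc d) (s≤s d≥2@(s≤s _)) n m G degree≤ no-K =
  proj₂ (proj₂ (q-B-minimum G)) _ (c , good⇒BColoring good)
  where
  open Colouring G
  -- Matching on `d≥2` shows `d` to be a successor, so the palette has `Fin.zero` as an element.
  coloured = colouring d (degree-≤ degree≤) d≥2 no-K Fin.zero n (allFin n) (≤-reflexive (length-tabulate (λ v → v)))
  c = proj₁ coloured
  good = proj₂ coloured
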